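{- Let $A_n=1$ if $n=2^{k+1}-2$ for some integer $k\ge0$ and $A_n=0$ otherwise, let $D(n)=\det\left(A_{i+j}\right)_{i,j=0}^{n-1}$ for $n\ge1$, $D(0)=1$ (it is known that $D(n)\in\{1,-1\}$), and let $T_n=\frac{D(n)D(n+2)}{D(n+1)^2}=D(n)D(n+2)$ for $n\ge0$. Then $T_0=1$, $T_1=-1$, and $$T_{2n}=T_{2n-1}T_{n-1}\quad(n\ge1),\qquad T_{2n+1}=-T_{2n}\quad(n\ge0).$$ -}

module Defs where

import Algebra.Definitions.RawMonoid as RawMonoid
open import Data.Bool.Base using (if_then_else_)
open import Data.Fin.Base using (Fin; zero; suc; toℕ; punchIn)
open import Data.Integer.Base as ℤ using (ℤ; 0ℤ; 1ℤ; -1ℤ)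
open import Data.Nat.Base as ℕ using (ℕ; zero; suc; _≤_; _<_; s≤s; z≤n)
import Data.Nat.Properties as ℕ
open import Data.Product.Base using (∃; _,_)
open import Data.Rational.Base as ℚ using (ℚ)
open import Data.Sum.Base using (_⊎_; inj₁; inj₂)
open import Relation.Binary.PropositionalEquality using (_≡_; refl; subst; sym)
open import Relation.Nullary.Decidable using (Dec; ⌊_⌋; map′)

-- Truncated subtraction is exact here, since 2 ≤ 2 ^ (k + 1).
TwoPowerMinusTwo : ℕ → Set
TwoPowerMinusTwo n = ∃ λ k → n ≡ 2 ℕ.^ suc k ℕ.∸ 2

private
  n<2^n : ∀ n → n < 2 ℕ.^ n
  n<2^n zero    = s≤s z≤n
  n<2^n (suc n) = ℕ.+-mono-≤ (ℕ.m^n>0 2 n)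
    (ℕ.≤-trans (n<2^n n) (ℕ.m≤m+n (2 ℕ.^ n) 0))

  k≤2^1+k∸2 : ∀ k → k ≤ 2 ℕ.^ suc k ℕ.∸ 2
  k≤2^1+k∸2 k = ℕ.∸-monoˡ-≤ 2 (n<2^n (suc k))

twoPowerMinusTwo? : ∀ n → Dec (TwoPowerMinusTwo n)
twoPowerMinusTwo? n = map′
  (λ (k , _ , eq) → k , eq)
  (λ (k , eq) → k , s≤s (subst (k ≤_) (sym eq) (k≤2^1+k∸2 k)) , eq)
  (ℕ.anyUpTo? (λ k → n ℕ.≟ 2 ℕ.^ suc k ℕ.∸ 2) (suc n))

A : ℕ → ℤ
A n = if ⌊ twoPowerMinusTwo? n ⌋ then 1ℤ else 0ℤ

Matrix : ℕ → Set
Matrix n = Fin n → Fin n → ℤ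

-- Laplace expansion along the first row; the empty determinant is 1.
det : ∀ {n} → Matrix n → ℤ
det {zero}  M = 1ℤ
det {suc n} M = RawMonoid.sum ℤ.+-0-rawMonoid λ j →
  -1ℤ ℤ.^ toℕ j ℤ.* M zero j ℤ.* det (λ i k → M (suc i) (punchIn j k))

D : ℕ → ℤ
D n = det {n} λ i j → A (toℕ i ℕ.+ toℕ j)

D≡±1 : Set
D≡±1 = ∀ n → D n ≡ 1ℤ ⊎ D n ≡ -1ℤ

fromℤ : ℤ → ℚ
fromℤ x = x ℚ./ 1

private
  ±1⇒square≢0 : ∀ {x} → x ≡ 1ℤ ⊎ x ≡ -1ℤ → ℚ.NonZero (fromℤ (x ℤ.^ 2))
  ±1⇒square≢0 (inj₁ refl) = _
  ±1⇒square≢0 (inj₂ refl) = _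

-- The proof argument only serves to make the denominator nonzero; being
-- irrelevant, it cannot influence the value.
T : .D≡±1 → ℕ → ℚ
T h n = (fromℤ (D n ℤ.* D (n ℕ.+ 2)) ℚ.÷ fromℤ (D (n ℕ.+ 1) ℤ.^ 2))
  {{±1⇒square≢0 (h (n ℕ.+ 1))}}

{-# OPTIONS --safe #-}
-- The sequence A satisfies A(0) = 1, A(2m+1) = 0 and A(2m+2) = A(m). Sorting
-- rows and columns by parity splits the Hankel matrix of A into two diagonal
-- blocks, so D(n) = E(⌈n/2⌉) D(⌊n/2⌋), where E(n) is the Hankel determinant of
-- m ↦ A(2m). That matrix, apart from its corner entry A(0) = 1, has nonzero
-- entries only for i + j odd, and so has the minor obtained by deleting the
-- first row and column. Expanding along the corner therefore leaves a single
-- term, antidiagonal with two equal blocks: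
--   E(2k) = (-1)^k E(k)²   and   E(2k+1) = (-1)^k D(k)².
-- By induction all these determinants are ±1 and E(n) = (-1)^⌊n/2⌋; the
-- recurrences for T follow from E(n) E(n+2) = -1.
module Submission where

open import Defs
open import Data.Integer.Base as ℤ using (ℤ)
open import Data.Nat.Base using (ℕ; _+_; _∸_; _≥_) renaming (_*_ to _·_)
open import Data.Product.Base using (Σ-syntax; _×_)
open import Data.Rational.Base using (ℚ; 1ℚ; _*_; -_)
open import Relation.Binary.PropositionalEquality using (_≡_)

import Algebra.Definitions.RawMonoid as RawMonoid
open import Data.Fin.Base using (Fin; zero; suc; toℕ; punchIn)
open import Data.Integer.Base using (0ℤ; 1ℤ; -1ℤ)
import Data.Integer.Properties as ℤ
open import Data.Integer.Tactic.RingSolver using (solve-∀)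
open import Data.List.Base using (List; []; _∷_; length; map; mapMaybe; tabulate; applyUpTo; upTo)
open import Data.List.Properties using (length-applyUpTo; map-applyUpTo)
open import Data.Nat.Base using (zero; suc; _<_; s≤s; _^_; ⌊_/2⌋; ⌈_/2⌉)
open import Data.Nat.Induction using (<-rec)
import Data.Nat.Properties as ℕ
open import Data.Product.Base using (_,_; proj₁; proj₂)
open import Data.Rational.Base as ℚ using (_÷_)
import Data.Rational.Properties as ℚ
open import Data.Sum using (_⊎_; inj₁; inj₂; isInj₁; isInj₂; [_,_]′)
open import Function.Base using (_∘_; id)
open import Relation.Binary.PropositionalEquality
  using (_≢_; _≗_; refl; sym; trans; cong; cong₂; subst; module ≡-Reasoning)
open import Relation.Nullary using (yes; no; contradiction)

open ≡-Reasoning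

private
  variable
    I I′ J J′ : Set

-- Determinants by Laplace expansion over lists of row and column labels.

lefts : List (I ⊎ J) → List I
lefts = mapMaybe isInj₁

rights : List (I ⊎ J) → List J
rights = mapMaybe isInj₂

-- expand x f cs = Σ_j (-1)^j * x (c_j) * f (cs without c_j).
expand : (J → ℤ) → (List J → ℤ) → List J → ℤ
expand x f []       = 0ℤ
expand x f (c ∷ cs) = x c ℤ.* f cs ℤ.- expand x (f ∘ (c ∷_)) cs

-- Zero when the numbers of rows and columns differ, so that the block formula
-- below needs no hypothesis on the sizes of the blocks.
ldet : (I → J → ℤ) → List I → List J → ℤ
ldet X []       []      = 1ℤ
ldet X []       (_ ∷ _) = 0ℤ
ldet X (r ∷ rs) cs      = expand (X r) (ldet X rs) cs

expand-cong : {x y : J → ℤ} {f g : List J → ℤ} → x ≗ y → f ≗ g → expand x f ≗ expand y g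
expand-cong x≗y f≗g []       = refl
expand-cong x≗y f≗g (c ∷ cs) = cong₂ ℤ._-_
  (cong₂ ℤ._*_ (x≗y c) (f≗g cs)) (expand-cong x≗y (f≗g ∘ (c ∷_)) cs)

expand-scale : ∀ (x : J → ℤ) k f cs → expand x (λ ds → k ℤ.* f ds) cs ≡ k ℤ.* expand x f cs
expand-scale x k f []       = sym (ℤ.*-zeroʳ k)
expand-scale x k f (c ∷ cs) =
  trans (cong (ℤ._-_ (x c ℤ.* (k ℤ.* f cs))) (expand-scale x k (f ∘ (c ∷_)) cs))
        (rearrange (x c) k (f cs) (expand x (f ∘ (c ∷_)) cs))
  where
  rearrange : ∀ x k f e → x ℤ.* (k ℤ.* f) ℤ.- k ℤ.* e ≡ k ℤ.* (x ℤ.* f ℤ.- e)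
  rearrange = solve-∀

-- Every list passed to `f` is one shorter than `cs`, so the sign is constant along the expansion.
expand-sign : ∀ (x : J → ℤ) f cs →
  expand x (λ ds → -1ℤ ℤ.^ length ds ℤ.* f ds) cs ≡ ℤ.- (-1ℤ ℤ.^ length cs ℤ.* expand x f cs)
expand-sign x f []       = refl
expand-sign x f (c ∷ cs) = begin
  x c ℤ.* (s ℤ.* f cs) ℤ.- expand x (λ ds → -1ℤ ℤ.* -1ℤ ℤ.^ length ds ℤ.* f (c ∷ ds)) cs
    ≡⟨ cong (ℤ._-_ (x c ℤ.* (s ℤ.* f cs))) (trans
         (expand-cong (λ _ → refl) (λ ds → ℤ.*-assoc -1ℤ (-1ℤ ℤ.^ length ds) (f (c ∷ ds))) cs)
         (trans (expand-scale x -1ℤ (λ ds → -1ℤ ℤ.^ length ds ℤ.* f (c ∷ ds)) cs)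
                (cong (-1ℤ ℤ.*_) (expand-sign x (f ∘ (c ∷_)) cs)))) ⟩
  x c ℤ.* (s ℤ.* f cs) ℤ.- -1ℤ ℤ.* (ℤ.- (s ℤ.* expand x (f ∘ (c ∷_)) cs))
    ≡⟨ rearrange (x c) s (f cs) (expand x (f ∘ (c ∷_)) cs) ⟩
  ℤ.- (-1ℤ ℤ.* s ℤ.* (x c ℤ.* f cs ℤ.- expand x (f ∘ (c ∷_)) cs)) ∎
  where
  s = -1ℤ ℤ.^ length cs
  rearrange : ∀ x s f e →
    x ℤ.* (s ℤ.* f) ℤ.- -1ℤ ℤ.* (ℤ.- (s ℤ.* e)) ≡ ℤ.- (-1ℤ ℤ.* s ℤ.* (x ℤ.* f ℤ.- e))
  rearrange = solve-∀

expand-map : ∀ (φ : J → J′) (x : J′ → ℤ) f cs →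
  expand x f (map φ cs) ≡ expand (x ∘ φ) (f ∘ map φ) cs
expand-map φ x f []       = refl
expand-map φ x f (c ∷ cs) = cong (ℤ._-_ (x (φ c) ℤ.* f (map φ cs))) (expand-map φ x (f ∘ (φ c ∷_)) cs)

expand-vanishes : ∀ (x : J → ℤ) f cs →
  (∀ ds → suc (length ds) ≡ length cs → f ds ≡ 0ℤ) → expand x f cs ≡ 0ℤ
expand-vanishes x f []       f≡0 = refl
expand-vanishes x f (c ∷ cs) f≡0 = cong₂ ℤ._-_
  (trans (cong (x c ℤ.*_) (f≡0 cs refl)) (ℤ.*-zeroʳ (x c)))
  (expand-vanishes x (f ∘ (c ∷_)) cs λ ds eq → f≡0 (c ∷ ds) (cong suc eq))

ldet-cong : {X Y : I → J → ℤ} → (∀ i j → X i j ≡ Y i j) → ∀ rs cs → ldet X rs cs ≡ ldet Y rs cs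
ldet-cong X≗Y []       []      = refl
ldet-cong X≗Y []       (_ ∷ _) = refl
ldet-cong X≗Y (r ∷ rs) cs      = expand-cong (X≗Y r) (ldet-cong X≗Y rs) cs

ldet-mapRows : ∀ (φ : I → I′) (X : I′ → J → ℤ) rs cs →
  ldet X (map φ rs) cs ≡ ldet (λ i → X (φ i)) rs cs
ldet-mapRows φ X []       []      = refl
ldet-mapRows φ X []       (_ ∷ _) = refl
ldet-mapRows φ X (r ∷ rs) cs      = expand-cong (λ _ → refl) (ldet-mapRows φ X rs) cs

ldet-mapCols : ∀ (ψ : J → J′) (X : I → J′ → ℤ) rs cs →
  ldet X rs (map ψ cs) ≡ ldet (λ i j → X i (ψ j)) rs cs
ldet-mapCols ψ X []       []      = refl
ldet-mapCols ψ X []       (_ ∷ _) = refl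
ldet-mapCols ψ X (r ∷ rs) cs      = trans (expand-map ψ (X r) (ldet X rs) cs)
  (expand-cong (λ _ → refl) (ldet-mapCols ψ X rs) cs)

ldet-map : ∀ (φ : I → I′) (ψ : J → J′) X rs cs →
  ldet X (map φ rs) (map ψ cs) ≡ ldet (λ i j → X (φ i) (ψ j)) rs cs
ldet-map φ ψ X rs cs = trans (ldet-mapRows φ X rs (map ψ cs)) (ldet-mapCols ψ (X ∘ φ) rs cs)

-- Each expansion step removes one row and one column, so the difference of lengths persists until
-- one list runs out, where the value is 0 by definition.
ldet-nonsquare : ∀ (X : I → J → ℤ) rs cs → length rs ≢ length cs → ldet X rs cs ≡ 0ℤ
ldet-nonsquare X []       []      neq = contradiction refl neq
ldet-nonsquare X []       (_ ∷ _) neq = refl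
ldet-nonsquare X (r ∷ rs) cs      neq = expand-vanishes (X r) (ldet X rs) cs
  λ ds eq → ldet-nonsquare X rs ds λ eq′ → neq (trans (cong suc eq′) eq)

-- Either the lengths agree or both sides vanish. This trades the column count produced by
-- `expand-rights` for the row count in `shuffleSign`.
ldet-sign : ∀ (X : I → J → ℤ) rs cs →
  -1ℤ ℤ.^ length cs ℤ.* ldet X rs cs ≡ -1ℤ ℤ.^ length rs ℤ.* ldet X rs cs
ldet-sign X rs cs with length rs ℕ.≟ length cs
... | yes eq = cong (λ l → -1ℤ ℤ.^ l ℤ.* ldet X rs cs) (sym eq)
... | no neq rewrite ldet-nonsquare X rs cs neq =
  trans (ℤ.*-zeroʳ (-1ℤ ℤ.^ length cs)) (sym (ℤ.*-zeroʳ (-1ℤ ℤ.^ length rs)))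

-- Determinants of block diagonal matrices with interleaved blocks.

-- The sign of the permutation moving all lefts in front of all rights.
shuffleSign : List (I ⊎ J) → ℤ
shuffleSign []            = 1ℤ
shuffleSign (inj₁ _ ∷ zs) = shuffleSign zs
shuffleSign (inj₂ _ ∷ zs) = -1ℤ ℤ.^ length (lefts zs) ℤ.* shuffleSign zs

-1^n*-1^n≡1 : ∀ n → -1ℤ ℤ.^ n ℤ.* -1ℤ ℤ.^ n ≡ 1ℤ
-1^n*-1^n≡1 zero    = refl
-1^n*-1^n≡1 (suc n) = trans (rearrange (-1ℤ ℤ.^ n)) (-1^n*-1^n≡1 n)
  where
  rearrange : ∀ s → -1ℤ ℤ.* s ℤ.* (-1ℤ ℤ.* s) ≡ s ℤ.* s
  rearrange = solve-∀

*-interchange : ∀ a b c d → a ℤ.* b ℤ.* (c ℤ.* d) ≡ a ℤ.* c ℤ.* (b ℤ.* d)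
*-interchange = solve-∀

shuffleSign² : (zs : List (I ⊎ J)) → shuffleSign zs ℤ.* shuffleSign zs ≡ 1ℤ
shuffleSign² []            = refl
shuffleSign² (inj₁ _ ∷ zs) = shuffleSign² zs
shuffleSign² (inj₂ _ ∷ zs) = trans
  (*-interchange (-1ℤ ℤ.^ length (lefts zs)) (shuffleSign zs) _ _)
  (cong₂ ℤ._*_ (-1^n*-1^n≡1 (length (lefts zs))) (shuffleSign² zs))

-- Removing a left column flips `shuffleSign` once for each right column before it. This is exactly
-- the discrepancy between its alternating sign in `cs` and the one in `lefts cs`.
expand-lefts : ∀ (x : J ⊎ J′ → ℤ) (g : List J → ℤ) (h : List J′ → ℤ) →
  (∀ j → x (inj₂ j) ≡ 0ℤ) → ∀ cs →
  expand x (λ ds → shuffleSign ds ℤ.* (g (lefts ds) ℤ.* h (rights ds))) cs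
    ≡ shuffleSign cs ℤ.* (expand (x ∘ inj₁) g (lefts cs) ℤ.* h (rights cs))
expand-lefts x g h x≡0 []            = refl
expand-lefts x g h x≡0 (inj₁ c ∷ cs) =
  trans (cong (ℤ._-_ (x (inj₁ c) ℤ.* (s ℤ.* (g (lefts cs) ℤ.* k))))
          (expand-lefts x (g ∘ (c ∷_)) h x≡0 cs))
        (rearrange (x (inj₁ c)) s (g (lefts cs)) k _)
  where
  s = shuffleSign cs
  k = h (rights cs)
  rearrange : ∀ x s g h e →
    x ℤ.* (s ℤ.* (g ℤ.* h)) ℤ.- s ℤ.* (e ℤ.* h) ≡ s ℤ.* ((x ℤ.* g ℤ.- e) ℤ.* h)
  rearrange = solve-∀
expand-lefts x g h x≡0 (inj₂ c ∷ cs) = begin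
  x (inj₂ c) ℤ.* m ℤ.- expand x (λ ds → -1ℤ ℤ.^ length (lefts ds) ℤ.* shuffleSign ds
    ℤ.* (g (lefts ds) ℤ.* h (c ∷ rights ds))) cs
    ≡⟨ cong₂ (λ y e → y ℤ.* m ℤ.- e) (x≡0 c)
         -- The sign contributed by the head `c` depends only on the remaining left columns, so it
         -- is moved into `g` before recursing.
         (trans (expand-cong (λ _ → refl) (λ ds → absorb (-1ℤ ℤ.^ length (lefts ds))
                   (shuffleSign ds) (g (lefts ds)) (h (c ∷ rights ds))) cs)
                (expand-lefts x (λ ds → -1ℤ ℤ.^ length ds ℤ.* g ds) (h ∘ (c ∷_)) x≡0 cs)) ⟩
  0ℤ ℤ.* m ℤ.- s ℤ.* (expand (x ∘ inj₁) (λ ds → -1ℤ ℤ.^ length ds ℤ.* g ds) (lefts cs) ℤ.* k)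
    ≡⟨ cong (λ e → 0ℤ ℤ.* m ℤ.- s ℤ.* (e ℤ.* k)) (expand-sign (x ∘ inj₁) g (lefts cs)) ⟩
  0ℤ ℤ.* m ℤ.- s ℤ.* (ℤ.- (t ℤ.* expand (x ∘ inj₁) g (lefts cs)) ℤ.* k)
    ≡⟨ rearrange m s t (expand (x ∘ inj₁) g (lefts cs)) k ⟩
  t ℤ.* s ℤ.* (expand (x ∘ inj₁) g (lefts cs) ℤ.* k) ∎
  where
  m = shuffleSign cs ℤ.* (g (lefts cs) ℤ.* h (rights cs))
  s = shuffleSign cs
  t = -1ℤ ℤ.^ length (lefts cs)
  k = h (c ∷ rights cs)
  absorb : ∀ t s g h → t ℤ.* s ℤ.* (g ℤ.* h) ≡ s ℤ.* (t ℤ.* g ℤ.* h)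
  absorb = solve-∀
  rearrange : ∀ m s t e k → 0ℤ ℤ.* m ℤ.- s ℤ.* (ℤ.- (t ℤ.* e) ℤ.* k) ≡ t ℤ.* s ℤ.* (e ℤ.* k)
  rearrange = solve-∀

-- Removing a right column drops the sign for the left columns after it, while its alternating sign
-- counts the left columns before it. Together they count all left columns, whichever column is
-- removed.
expand-rights : ∀ (x : J ⊎ J′ → ℤ) (g : List J → ℤ) (h : List J′ → ℤ) →
  (∀ j → x (inj₁ j) ≡ 0ℤ) → ∀ cs →
  expand x (λ ds → shuffleSign ds ℤ.* (g (lefts ds) ℤ.* h (rights ds))) cs
    ≡ shuffleSign cs
        ℤ.* (-1ℤ ℤ.^ length (lefts cs) ℤ.* g (lefts cs) ℤ.* expand (x ∘ inj₂) h (rights cs))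
expand-rights x g h x≡0 []            = rearrange (g [])
  where
  rearrange : ∀ g → 0ℤ ≡ 1ℤ ℤ.* (1ℤ ℤ.* g ℤ.* 0ℤ)
  rearrange = solve-∀
expand-rights x g h x≡0 (inj₁ c ∷ cs) =
  trans (cong₂ (λ y e → y ℤ.* m ℤ.- e) (x≡0 c) (expand-rights x (g ∘ (c ∷_)) h x≡0 cs))
        (rearrange m (shuffleSign cs) (-1ℤ ℤ.^ length (lefts cs)) (g (c ∷ lefts cs)) _)
  where
  m = shuffleSign cs ℤ.* (g (lefts cs) ℤ.* h (rights cs))
  rearrange : ∀ m s t g e →
    0ℤ ℤ.* m ℤ.- s ℤ.* (t ℤ.* g ℤ.* e) ≡ s ℤ.* (-1ℤ ℤ.* t ℤ.* g ℤ.* e)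
  rearrange = solve-∀
expand-rights x g h x≡0 (inj₂ c ∷ cs) = begin
  x (inj₂ c) ℤ.* (s ℤ.* (g′ ℤ.* k)) ℤ.- expand x (λ ds →
    -1ℤ ℤ.^ length (lefts ds) ℤ.* shuffleSign ds ℤ.* (g (lefts ds) ℤ.* h (c ∷ rights ds))) cs
    ≡⟨ cong (ℤ._-_ (x (inj₂ c) ℤ.* (s ℤ.* (g′ ℤ.* k))))
         (trans (expand-cong (λ _ → refl) (λ ds → absorb (-1ℤ ℤ.^ length (lefts ds))
                   (shuffleSign ds) (g (lefts ds)) (h (c ∷ rights ds))) cs)
                (expand-rights x (λ ds → -1ℤ ℤ.^ length ds ℤ.* g ds) (h ∘ (c ∷_)) x≡0 cs)) ⟩
  x (inj₂ c) ℤ.* (s ℤ.* (g′ ℤ.* k)) ℤ.- s ℤ.* (t ℤ.* (t ℤ.* g′) ℤ.* e)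
    ≡⟨ factor (x (inj₂ c)) s g′ k t e ⟩
  s ℤ.* (g′ ℤ.* (x (inj₂ c) ℤ.* k)) ℤ.- t ℤ.* t ℤ.* (s ℤ.* (g′ ℤ.* e))
    -- Inserting `t * t = 1` in the first term gives both terms a common factor.
    ≡⟨ cong (λ y → y ℤ.- t ℤ.* t ℤ.* (s ℤ.* (g′ ℤ.* e)))
         (trans (sym (ℤ.*-identityˡ _))
                (cong (ℤ._* (s ℤ.* (g′ ℤ.* (x (inj₂ c) ℤ.* k))))
                      (sym (-1^n*-1^n≡1 (length (lefts cs)))))) ⟩
  t ℤ.* t ℤ.* (s ℤ.* (g′ ℤ.* (x (inj₂ c) ℤ.* k))) ℤ.- t ℤ.* t ℤ.* (s ℤ.* (g′ ℤ.* e))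
    ≡⟨ rearrange (x (inj₂ c)) s g′ k t e ⟩
  t ℤ.* s ℤ.* (t ℤ.* g′ ℤ.* (x (inj₂ c) ℤ.* k ℤ.- e)) ∎
  where
  s = shuffleSign cs
  t = -1ℤ ℤ.^ length (lefts cs)
  k = h (rights cs)
  g′ = g (lefts cs)
  e = expand (x ∘ inj₂) (h ∘ (c ∷_)) (rights cs)
  absorb : ∀ t s g h → t ℤ.* s ℤ.* (g ℤ.* h) ≡ s ℤ.* (t ℤ.* g ℤ.* h)
  absorb = solve-∀
  factor : ∀ x s g k t e → x ℤ.* (s ℤ.* (g ℤ.* k)) ℤ.- s ℤ.* (t ℤ.* (t ℤ.* g) ℤ.* e)
    ≡ s ℤ.* (g ℤ.* (x ℤ.* k)) ℤ.- t ℤ.* t ℤ.* (s ℤ.* (g ℤ.* e))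
  factor = solve-∀
  rearrange : ∀ x s g k t e →
    t ℤ.* t ℤ.* (s ℤ.* (g ℤ.* (x ℤ.* k))) ℤ.- t ℤ.* t ℤ.* (s ℤ.* (g ℤ.* e))
    ≡ t ℤ.* s ℤ.* (t ℤ.* g ℤ.* (x ℤ.* k ℤ.- e))
  rearrange = solve-∀

-- The two `shuffleSign` factors are the signs of sorting rows and columns into block order. In the
-- induction the first row meets only the columns of its own block.
ldet-block : (X : I ⊎ I′ → J ⊎ J′ → ℤ) →
  (∀ i j → X (inj₁ i) (inj₂ j) ≡ 0ℤ) → (∀ i j → X (inj₂ i) (inj₁ j) ≡ 0ℤ) → ∀ rs cs →
  ldet X rs cs ≡ shuffleSign rs ℤ.* shuffleSign cs
    ℤ.* (ldet (λ i j → X (inj₁ i) (inj₁ j)) (lefts rs) (lefts cs)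
      ℤ.* ldet (λ i j → X (inj₂ i) (inj₂ j)) (rights rs) (rights cs))
ldet-block X X₁₂≡0 X₂₁≡0 [] [] = refl
ldet-block X X₁₂≡0 X₂₁≡0 [] (inj₁ _ ∷ cs) = sym (ℤ.*-zeroʳ (1ℤ ℤ.* shuffleSign cs))
ldet-block X X₁₂≡0 X₂₁≡0 [] (inj₂ c ∷ cs) = vanish (1ℤ ℤ.* shuffleSign (inj₂ c ∷ cs))
  (ldet (λ i j → X (inj₁ i) (inj₁ j)) [] (lefts cs))
  where
  vanish : ∀ s d → 0ℤ ≡ s ℤ.* (d ℤ.* 0ℤ)
  vanish = solve-∀
ldet-block {I = I} {I′ = I′} {J = J} {J′ = J′} X X₁₂≡0 X₂₁≡0 (r ∷ rs) cs = begin
  expand (X r) (ldet X rs) cs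
    ≡⟨ expand-cong (λ _ → refl) (λ ds → trans (ldet-block X X₁₂≡0 X₂₁≡0 rs ds)
         (ℤ.*-assoc (shuffleSign rs) (shuffleSign ds) _)) cs ⟩
  expand (X r) (λ ds → shuffleSign rs ℤ.* (shuffleSign ds ℤ.* (g (lefts ds) ℤ.* h (rights ds)))) cs
    ≡⟨ expand-scale (X r) (shuffleSign rs) _ cs ⟩
  shuffleSign rs
    ℤ.* expand (X r) (λ ds → shuffleSign ds ℤ.* (g (lefts ds) ℤ.* h (rights ds))) cs
    ≡⟨ byRow r ⟩
  _ ∎
  where
  X₁₁ : I → J → ℤ
  X₁₁ i j = X (inj₁ i) (inj₁ j)
  X₂₂ : I′ → J′ → ℤ
  X₂₂ i j = X (inj₂ i) (inj₂ j)
  g : List J → ℤ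
  g = ldet X₁₁ (lefts rs)
  h : List J′ → ℤ
  h = ldet X₂₂ (rights rs)
  rearrange : ∀ s u t d e → s ℤ.* (u ℤ.* (t ℤ.* d ℤ.* e)) ≡ t ℤ.* s ℤ.* u ℤ.* (d ℤ.* e)
  rearrange = solve-∀
  byRow : ∀ r →
    shuffleSign rs ℤ.* expand (X r) (λ ds → shuffleSign ds ℤ.* (g (lefts ds) ℤ.* h (rights ds))) cs
      ≡ shuffleSign (r ∷ rs) ℤ.* shuffleSign cs
        ℤ.* (ldet X₁₁ (lefts (r ∷ rs)) (lefts cs) ℤ.* ldet X₂₂ (rights (r ∷ rs)) (rights cs))
  byRow (inj₁ i) = trans
    (cong (shuffleSign rs ℤ.*_) (expand-lefts (X (inj₁ i)) g h (X₁₂≡0 i) cs))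
    (sym (ℤ.*-assoc (shuffleSign rs) (shuffleSign cs) _))
  byRow (inj₂ i) = trans
    (cong (shuffleSign rs ℤ.*_) (trans (expand-rights (X (inj₂ i)) g h (X₂₁≡0 i) cs)
      (cong (λ d → shuffleSign cs ℤ.* (d ℤ.* expand (X₂₂ i) h (rights cs)))
        (ldet-sign X₁₁ (lefts rs) (lefts cs)))))
    (rearrange (shuffleSign rs) (shuffleSign cs) (-1ℤ ℤ.^ length (lefts rs)) (g (lefts cs))
      (expand (X₂₂ i) h (rights cs)))

-- Agreement of the two forms of the determinant.

Σ-neg : ∀ n (a b d : Fin n → ℤ) →
  RawMonoid.sum ℤ.+-0-rawMonoid (λ j → -1ℤ ℤ.* a j ℤ.* b j ℤ.* d j)
    ≡ ℤ.- RawMonoid.sum ℤ.+-0-rawMonoid (λ j → a j ℤ.* b j ℤ.* d j)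
Σ-neg zero    a b d = refl
Σ-neg (suc n) a b d = trans
  (cong (ℤ._+_ (-1ℤ ℤ.* a zero ℤ.* b zero ℤ.* d zero)) (Σ-neg n (a ∘ suc) (b ∘ suc) (d ∘ suc)))
  (rearrange (a zero) (b zero) (d zero)
    (RawMonoid.sum ℤ.+-0-rawMonoid (λ j → a (suc j) ℤ.* b (suc j) ℤ.* d (suc j))))
  where
  rearrange : ∀ a b d e → -1ℤ ℤ.* a ℤ.* b ℤ.* d ℤ.+ ℤ.- e ≡ ℤ.- (a ℤ.* b ℤ.* d ℤ.+ e)
  rearrange = solve-∀

-- The minors `m` are kept abstract for the induction: `punchIn (suc j)` always retains column
-- `zero`, which the recursive call prepends through `f ∘ (c zero ∷_)`.
Σ-expand : ∀ {n} (x : J → ℤ) (c : Fin (suc n) → J) (m : Fin (suc n) → ℤ) f →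
  (∀ j → m j ≡ f (tabulate (c ∘ punchIn j))) →
  RawMonoid.sum ℤ.+-0-rawMonoid (λ j → -1ℤ ℤ.^ toℕ j ℤ.* x (c j) ℤ.* m j)
    ≡ expand x f (tabulate c)
Σ-expand {n = zero}  x c m f m≡f = cong (ℤ._+ 0ℤ)
  (cong₂ ℤ._*_ (ℤ.*-identityˡ (x (c zero))) (m≡f zero))
Σ-expand {n = suc n} x c m f m≡f = cong₂ ℤ._+_
  (cong₂ ℤ._*_ (ℤ.*-identityˡ (x (c zero))) (m≡f zero))
  (trans (Σ-neg (suc n) (λ j → -1ℤ ℤ.^ toℕ j) (x ∘ c ∘ suc) (m ∘ suc))
         (cong ℤ.-_ (Σ-expand x (c ∘ suc) (m ∘ suc) (f ∘ (c zero ∷_)) (m≡f ∘ suc))))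

-- Arbitrary `r` and `c` are needed because the minors are reindexed by `r ∘ suc` and
-- `c ∘ punchIn j`.
det≡ldet : ∀ {n} (X : I → J → ℤ) (r : Fin n → I) (c : Fin n → J) →
  det (λ i j → X (r i) (c j)) ≡ ldet X (tabulate r) (tabulate c)
det≡ldet {n = zero}  X r c = refl
det≡ldet {n = suc n} X r c = Σ-expand (X (r zero)) c _ (ldet X (tabulate (r ∘ suc)))
  λ j → det≡ldet X (r ∘ suc) (c ∘ punchIn j)

-- Splitting off the corner entry.

clearCorner : (ℕ → ℕ → ℤ) → ℕ → ℕ → ℤ
clearCorner X zero    zero    = 0ℤ
clearCorner X zero    (suc j) = X zero (suc j)
clearCorner X (suc i) j       = X (suc i) j

-- The determinant is linear in the first row. All terms but the corner one use only entries where
-- `clearCorner X` agrees with `X`.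
ldet-corner : ∀ X rs cs →
  ldet X (0 ∷ map suc rs) (0 ∷ map suc cs)
    ≡ X 0 0 ℤ.* ldet (λ i j → X (suc i) (suc j)) rs cs
      ℤ.+ ldet (clearCorner X) (0 ∷ map suc rs) (0 ∷ map suc cs)
ldet-corner X rs cs = begin
  X 0 0 ℤ.* ldet X (map suc rs) (map suc cs)
    ℤ.- expand (X 0) (λ ds → ldet X (map suc rs) (0 ∷ ds)) (map suc cs)
    ≡⟨ cong₂ (λ d e → X 0 0 ℤ.* d ℤ.- e) (ldet-map suc suc X rs cs) (begin
         expand (X 0) (λ ds → ldet X (map suc rs) (0 ∷ ds)) (map suc cs)
           ≡⟨ expand-map suc (X 0) _ cs ⟩
         expand (λ j → X 0 (suc j)) (λ ds → ldet X (map suc rs) (0 ∷ map suc ds)) cs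
           ≡⟨ expand-cong (λ _ → refl) (λ ds → trans
                (ldet-mapRows suc X rs (0 ∷ map suc ds))
                (sym (ldet-mapRows suc (clearCorner X) rs (0 ∷ map suc ds)))) cs ⟩
         expand (λ j → X 0 (suc j)) (λ ds → ldet (clearCorner X) (map suc rs) (0 ∷ map suc ds)) cs
           ≡⟨ expand-map suc (clearCorner X 0) _ cs ⟨
         e′ ∎) ⟩
  X 0 0 ℤ.* d ℤ.- e′
    ≡⟨ rearrange (X 0 0) d (ldet (clearCorner X) (map suc rs) (map suc cs)) e′ ⟩
  X 0 0 ℤ.* d ℤ.+ (0ℤ ℤ.* ldet (clearCorner X) (map suc rs) (map suc cs) ℤ.- e′) ∎
  where
  d = ldet (λ i j → X (suc i) (suc j)) rs cs
  e′ = expand (clearCorner X 0) (λ ds → ldet (clearCorner X) (map suc rs) (0 ∷ ds)) (map suc cs)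
  rearrange : ∀ x d m e → x ℤ.* d ℤ.- e ≡ x ℤ.* d ℤ.+ (0ℤ ℤ.* m ℤ.- e)
  rearrange = solve-∀

-- Sorting indices by parity.

alternate : (f g : ℕ → I) → ℕ → I
alternate f g zero          = f 0
alternate f g (suc zero)    = g 0
alternate f g (suc (suc n)) = alternate (f ∘ suc) (g ∘ suc) n

∘-alternate : ∀ (h : I → J) f g → h ∘ alternate f g ≗ alternate (h ∘ f) (h ∘ g)
∘-alternate h f g zero          = refl
∘-alternate h f g (suc zero)    = refl
∘-alternate h f g (suc (suc n)) = ∘-alternate h (f ∘ suc) (g ∘ suc) n

alternate-parity : ∀ (f g h : ℕ → I) →
  (∀ a → f a ≡ h (2 · a)) → (∀ a → g a ≡ h (suc (2 · a))) → alternate f g ≗ h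
alternate-parity f g h f≗ g≗ zero          = f≗ 0
alternate-parity f g h f≗ g≗ (suc zero)    = g≗ 0
alternate-parity f g h f≗ g≗ (suc (suc n)) =
  alternate-parity (f ∘ suc) (g ∘ suc) (λ m → h (suc (suc m)))
    (λ a → trans (f≗ (suc a)) (cong h (ℕ.*-suc 2 a)))
    (λ a → trans (g≗ (suc a)) (cong (h ∘ suc) (ℕ.*-suc 2 a))) n

applyUpTo-cong : {f g : ℕ → I} → f ≗ g → ∀ n → applyUpTo f n ≡ applyUpTo g n
applyUpTo-cong f≗g zero    = refl
applyUpTo-cong f≗g (suc n) = cong₂ _∷_ (f≗g 0) (applyUpTo-cong (f≗g ∘ suc) n)

-- Presents the range as a list tagged by parity, with `φ` forgetting the tags; `f` and `g` decide
-- which parity counts as left.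
upTo-alternate : ∀ (φ : I → ℕ) f g →
  (∀ a → φ (f a) ≡ 2 · a) → (∀ a → φ (g a) ≡ suc (2 · a)) → ∀ n →
  upTo n ≡ map φ (applyUpTo (alternate f g) n)
upTo-alternate φ f g φf φg n = sym (trans (map-applyUpTo (alternate f g) φ n)
  (applyUpTo-cong (λ m → trans (∘-alternate φ f g m)
    (alternate-parity (φ ∘ f) (φ ∘ g) id φf φg m)) n))

lefts-inj₁-first : ∀ (f : ℕ → I) (g : ℕ → J) n →
  lefts (applyUpTo (alternate (inj₁ ∘ f) (inj₂ ∘ g)) n) ≡ applyUpTo f ⌈ n /2⌉
lefts-inj₁-first f g zero          = refl
lefts-inj₁-first f g (suc zero)    = refl
lefts-inj₁-first f g (suc (suc n)) = cong (f 0 ∷_) (lefts-inj₁-first (f ∘ suc) (g ∘ suc) n)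

rights-inj₁-first : ∀ (f : ℕ → I) (g : ℕ → J) n →
  rights (applyUpTo (alternate (inj₁ ∘ f) (inj₂ ∘ g)) n) ≡ applyUpTo g ⌊ n /2⌋
rights-inj₁-first f g zero          = refl
rights-inj₁-first f g (suc zero)    = refl
rights-inj₁-first f g (suc (suc n)) = cong (g 0 ∷_) (rights-inj₁-first (f ∘ suc) (g ∘ suc) n)

lefts-inj₂-first : ∀ (f : ℕ → J) (g : ℕ → I) n →
  lefts (applyUpTo (alternate (inj₂ ∘ f) (inj₁ ∘ g)) n) ≡ applyUpTo g ⌊ n /2⌋
lefts-inj₂-first f g zero          = refl
lefts-inj₂-first f g (suc zero)    = refl
lefts-inj₂-first f g (suc (suc n)) = cong (g 0 ∷_) (lefts-inj₂-first (f ∘ suc) (g ∘ suc) n)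

rights-inj₂-first : ∀ (f : ℕ → J) (g : ℕ → I) n →
  rights (applyUpTo (alternate (inj₂ ∘ f) (inj₁ ∘ g)) n) ≡ applyUpTo f ⌈ n /2⌉
rights-inj₂-first f g zero          = refl
rights-inj₂-first f g (suc zero)    = refl
rights-inj₂-first f g (suc (suc n)) = cong (f 0 ∷_) (rights-inj₂-first (f ∘ suc) (g ∘ suc) n)

-- In each pair of positions the right label of the second list precedes its left partner, so it
-- passes one more left label than in the first list. Every pair thus contributes one factor `-1`.
shuffleSign-alternate : ∀ (f : ℕ → I) (g : ℕ → I′) (f′ : ℕ → J) (g′ : ℕ → J′) n →
  ⌈ n /2⌉ ≡ ⌊ n /2⌋ →
  shuffleSign (applyUpTo (alternate (inj₁ ∘ f) (inj₂ ∘ g)) n)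
    ℤ.* shuffleSign (applyUpTo (alternate (inj₂ ∘ f′) (inj₁ ∘ g′)) n) ≡ -1ℤ ℤ.^ ⌊ n /2⌋
shuffleSign-alternate f g f′ g′ zero          _  = refl
shuffleSign-alternate f g f′ g′ (suc (suc n)) eq = begin
  -1ℤ ℤ.^ length (lefts zs) ℤ.* shuffleSign zs
    ℤ.* (-1ℤ ℤ.* -1ℤ ℤ.^ length (lefts zs′) ℤ.* shuffleSign zs′)
    ≡⟨ cong₂ (λ k l → -1ℤ ℤ.^ k ℤ.* shuffleSign zs ℤ.* (-1ℤ ℤ.* -1ℤ ℤ.^ l ℤ.* shuffleSign zs′))
         (trans (cong length (lefts-inj₁-first (f ∘ suc) (g ∘ suc) n))
                (trans (length-applyUpTo (f ∘ suc) ⌈ n /2⌉) (ℕ.suc-injective eq)))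
         (trans (cong length (lefts-inj₂-first (f′ ∘ suc) (g′ ∘ suc) n))
                (length-applyUpTo (g′ ∘ suc) ⌊ n /2⌋)) ⟩
  s ℤ.* shuffleSign zs ℤ.* (-1ℤ ℤ.* s ℤ.* shuffleSign zs′)
    ≡⟨ rearrange s (shuffleSign zs) (shuffleSign zs′) ⟩
  -1ℤ ℤ.* ((s ℤ.* s) ℤ.* (shuffleSign zs ℤ.* shuffleSign zs′))
    ≡⟨ cong (-1ℤ ℤ.*_) (trans
         (cong (ℤ._* (shuffleSign zs ℤ.* shuffleSign zs′)) (-1^n*-1^n≡1 ⌊ n /2⌋))
         (trans (ℤ.*-identityˡ _)
                (shuffleSign-alternate (f ∘ suc) (g ∘ suc) (f′ ∘ suc) (g′ ∘ suc) n
                  (ℕ.suc-injective eq)))) ⟩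
  -1ℤ ℤ.* s ∎
  where
  s = -1ℤ ℤ.^ ⌊ n /2⌋
  zs = applyUpTo (alternate (inj₁ ∘ f ∘ suc) (inj₂ ∘ g ∘ suc)) n
  zs′ = applyUpTo (alternate (inj₂ ∘ f′ ∘ suc) (inj₁ ∘ g′ ∘ suc)) n
  rearrange : ∀ s x y → s ℤ.* x ℤ.* (-1ℤ ℤ.* s ℤ.* y) ≡ -1ℤ ℤ.* ((s ℤ.* s) ℤ.* (x ℤ.* y))
  rearrange = solve-∀

-- Hankel determinants with a parity pattern of zeros.

hankel : (ℕ → ℤ) → ℕ → ℤ
hankel c n = ldet (λ i j → c (i + j)) (upTo n) (upTo n)

tabulate-toℕ : ∀ n (f : ℕ → I) → tabulate {n = n} (f ∘ toℕ) ≡ applyUpTo f n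
tabulate-toℕ zero    f = refl
tabulate-toℕ (suc n) f = cong (f 0 ∷_) (tabulate-toℕ n (f ∘ suc))

D≡hankel : ∀ n → D n ≡ hankel A n
D≡hankel n = trans (det≡ldet (λ i j → A (i + j)) (toℕ {n}) (toℕ {n}))
  (cong₂ (ldet (λ i j → A (i + j))) (tabulate-toℕ n id) (tabulate-toℕ n id))

even+even : ∀ a b → 2 · a + 2 · b ≡ 2 · (a + b)
even+even a b = sym (ℕ.*-distribˡ-+ 2 a b)

odd+even : ∀ a b → suc (2 · a) + 2 · b ≡ suc (2 · (a + b))
odd+even a b = cong suc (even+even a b)

even+odd : ∀ a b → 2 · a + suc (2 · b) ≡ suc (2 · (a + b))
even+odd a b = trans (ℕ.+-suc (2 · a) (2 · b)) (odd+even a b)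

odd+odd : ∀ a b → suc (2 · a) + suc (2 · b) ≡ 2 · suc (a + b)
odd+odd a b = trans (cong suc (even+odd a b)) (sym (ℕ.*-suc 2 (a + b)))

-- Rows and columns are sorted alike, so the two shuffle signs cancel. The odd block is again Hankel
-- because `(2a + 1) + (2b + 1) = 2(a + b + 1)`.
hankel-checkerboard : ∀ c → (∀ m → c (suc (2 · m)) ≡ 0ℤ) → ∀ n →
  hankel c n ≡ hankel (λ m → c (2 · m)) ⌈ n /2⌉ ℤ.* hankel (λ m → c (2 · suc m)) ⌊ n /2⌋
hankel-checkerboard c c-odd≡0 n = begin
  ldet C (upTo n) (upTo n)
    ≡⟨ cong₂ (ldet C) zs-upTo zs-upTo ⟩
  ldet C (map φ zs) (map φ zs)
    ≡⟨ ldet-map φ φ C zs zs ⟩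
  ldet X zs zs
    ≡⟨ ldet-block X (λ a b → trans (cong c (even+odd a b)) (c-odd≡0 (a + b)))
                    (λ a b → trans (cong c (odd+even a b)) (c-odd≡0 (a + b))) zs zs ⟩
  shuffleSign zs ℤ.* shuffleSign zs ℤ.* (d₁ ℤ.* d₂)
    ≡⟨ trans (cong (ℤ._* (d₁ ℤ.* d₂)) (shuffleSign² zs)) (ℤ.*-identityˡ (d₁ ℤ.* d₂)) ⟩
  d₁ ℤ.* d₂
    ≡⟨ cong₂ ℤ._*_
         (trans (ldet-cong (λ a b → cong c (even+even a b)) (lefts zs) (lefts zs))
           (cong₂ (ldet _) (lefts-inj₁-first id id n) (lefts-inj₁-first id id n)))
         (trans (ldet-cong (λ a b → cong c (odd+odd a b)) (rights zs) (rights zs))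
           (cong₂ (ldet _) (rights-inj₁-first id id n) (rights-inj₁-first id id n))) ⟩
  hankel (λ m → c (2 · m)) ⌈ n /2⌉ ℤ.* hankel (λ m → c (2 · suc m)) ⌊ n /2⌋ ∎
  where
  φ : ℕ ⊎ ℕ → ℕ
  φ = [ (2 ·_) , (λ a → suc (2 · a)) ]′
  zs = applyUpTo (alternate inj₁ inj₂) n
  zs-upTo = upTo-alternate φ inj₁ inj₂ (λ _ → refl) (λ _ → refl) n
  C : ℕ → ℕ → ℤ
  C i j = c (i + j)
  X : ℕ ⊎ ℕ → ℕ ⊎ ℕ → ℤ
  X i j = C (φ i) (φ j)
  d₁ = ldet (λ a b → X (inj₁ a) (inj₁ b)) (lefts zs) (lefts zs)
  d₂ = ldet (λ a b → X (inj₂ a) (inj₂ b)) (rights zs) (rights zs)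

-- The common shape of the corner minor and of the matrix with cleared corner: both off-diagonal
-- blocks come from one sequence `c`.
module Antidiagonal
  (M : ℕ → ℕ → ℤ) (c : ℕ → ℤ)
  (M-even-even : ∀ a b → M (2 · a) (2 · b) ≡ 0ℤ)
  (M-odd-odd   : ∀ a b → M (suc (2 · a)) (suc (2 · b)) ≡ 0ℤ)
  (M-even-odd  : ∀ a b → M (2 · a) (suc (2 · b)) ≡ c (a + b))
  (M-odd-even  : ∀ a b → M (suc (2 · a)) (2 · b) ≡ c (a + b))
  (n : ℕ)
  where

  private
    C : ℕ → ℕ → ℤ
    C a b = c (a + b)
    -- Pairs the even rows with the odd columns and vice versa.
    φ ψ : ℕ ⊎ ℕ → ℕ
    φ = [ (2 ·_) , (λ a → suc (2 · a)) ]′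
    ψ = [ (λ a → suc (2 · a)) , (2 ·_) ]′
    rs cs : List (ℕ ⊎ ℕ)
    rs = applyUpTo (alternate inj₁ inj₂) n
    cs = applyUpTo (alternate inj₂ inj₁) n
    X : ℕ ⊎ ℕ → ℕ ⊎ ℕ → ℤ
    X i j = M (φ i) (ψ j)

    ldet-factor : ldet M (upTo n) (upTo n) ≡ shuffleSign rs ℤ.* shuffleSign cs
      ℤ.* (ldet C (upTo ⌈ n /2⌉) (upTo ⌊ n /2⌋) ℤ.* ldet C (upTo ⌊ n /2⌋) (upTo ⌈ n /2⌉))
    ldet-factor = begin
      ldet M (upTo n) (upTo n)
        ≡⟨ cong₂ (ldet M) (upTo-alternate φ inj₁ inj₂ (λ _ → refl) (λ _ → refl) n)
                          (upTo-alternate ψ inj₂ inj₁ (λ _ → refl) (λ _ → refl) n) ⟩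
      ldet M (map φ rs) (map ψ cs)
        ≡⟨ ldet-map φ ψ M rs cs ⟩
      ldet X rs cs
        ≡⟨ ldet-block X M-even-even M-odd-odd rs cs ⟩
      shuffleSign rs ℤ.* shuffleSign cs
        ℤ.* (ldet (λ i j → X (inj₁ i) (inj₁ j)) (lefts rs) (lefts cs)
          ℤ.* ldet (λ i j → X (inj₂ i) (inj₂ j)) (rights rs) (rights cs))
        ≡⟨ cong (shuffleSign rs ℤ.* shuffleSign cs ℤ.*_) (cong₂ ℤ._*_
             (trans (ldet-cong M-even-odd (lefts rs) (lefts cs))
               (cong₂ (ldet C) (lefts-inj₁-first id id n) (lefts-inj₂-first id id n)))
             (trans (ldet-cong M-odd-even (rights rs) (rights cs))
               (cong₂ (ldet C) (rights-inj₁-first id id n) (rights-inj₂-first id id n)))) ⟩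
      _ ∎

  ldet-balanced : ⌈ n /2⌉ ≡ ⌊ n /2⌋ →
    ldet M (upTo n) (upTo n) ≡ -1ℤ ℤ.^ ⌊ n /2⌋ ℤ.* (hankel c ⌊ n /2⌋ ℤ.* hankel c ⌊ n /2⌋)
  ldet-balanced eq = trans ldet-factor (cong₂ ℤ._*_
    (shuffleSign-alternate id id id id n eq)
    (cong (λ l → ldet C (upTo l) (upTo ⌊ n /2⌋) ℤ.* ldet C (upTo ⌊ n /2⌋) (upTo l)) eq))

  -- For odd `n` there is one more even index than odd, so neither block is square.
  ldet-unbalanced : ⌈ n /2⌉ ≢ ⌊ n /2⌋ → ldet M (upTo n) (upTo n) ≡ 0ℤ
  ldet-unbalanced neq = trans ldet-factor (trans
    (cong (λ d → shuffleSign rs ℤ.* shuffleSign cs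
                   ℤ.* (d ℤ.* ldet C (upTo ⌊ n /2⌋) (upTo ⌈ n /2⌉)))
      (ldet-nonsquare C (upTo ⌈ n /2⌉) (upTo ⌊ n /2⌋) λ eq → neq
        (trans (sym (length-applyUpTo id ⌈ n /2⌉)) (trans eq (length-applyUpTo id ⌊ n /2⌋)))))
    (ℤ.*-zeroʳ (shuffleSign rs ℤ.* shuffleSign cs)))

-- Recurrences of the sequence `A`.

2^[1+k]∸2-double : ∀ k → 2 · suc (2 ^ suc k ∸ 2) ≡ 2 ^ suc (suc k) ∸ 2
2^[1+k]∸2-double k = begin
  2 · suc (p ∸ 2)      ≡⟨ ℕ.*-suc 2 (p ∸ 2) ⟩
  2 + 2 · (p ∸ 2)      ≡⟨ cong (2 +_) (ℕ.*-distribˡ-∸ 2 p 2) ⟩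
  -- The bound `4 ≤ 2 · p` comes from doubling `1 ≤ 2 ^ k` twice; `(2 + 2 · p) ∸ 4` then computes to
  -- `2 · p ∸ 2`.
  2 + (2 · p ∸ 4)      ≡⟨ ℕ.+-∸-assoc 2 (ℕ.*-monoʳ-≤ 2 (ℕ.*-monoʳ-≤ 2 (ℕ.m^n>0 2 k))) ⟨
  2 · p ∸ 2            ∎
  where p = 2 ^ suc k

A-cong : ∀ {m n} → (TwoPowerMinusTwo m → TwoPowerMinusTwo n) →
  (TwoPowerMinusTwo n → TwoPowerMinusTwo m) → A m ≡ A n
A-cong {m} {n} to from with twoPowerMinusTwo? m | twoPowerMinusTwo? n
... | yes _ | yes _ = refl
... | no _  | no _  = refl
... | yes p | no ¬q = contradiction (to p) ¬q
... | no ¬p | yes q = contradiction (from q) ¬p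

A-odd : ∀ m → A (suc (2 · m)) ≡ 0ℤ
A-odd m with twoPowerMinusTwo? (suc (2 · m))
... | no _         = refl
... | yes (k , eq) = contradiction
  -- The number `2 ^ suc k ∸ 2` equals `2 · (2 ^ k ∸ 1)`, hence is even.
  (trans (ℕ.*-distribˡ-∸ 2 (2 ^ k) 1) (sym eq)) (ℕ.even≢odd (2 ^ k ∸ 1) m)

A-even : ∀ m → A (2 · suc m) ≡ A m
A-even m = A-cong to from
  where
  to : TwoPowerMinusTwo (2 · suc m) → TwoPowerMinusTwo m
  -- The index `k = 0` would give the number 0, which `2 · suc m` is not.
  to (suc k , eq) = k , ℕ.suc-injective
    (ℕ.*-cancelˡ-≡ (suc m) (suc (2 ^ suc k ∸ 2)) 2 (trans eq (sym (2^[1+k]∸2-double k))))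
  from : TwoPowerMinusTwo m → TwoPowerMinusTwo (2 · suc m)
  from (k , eq) = suc k , trans (cong (λ l → 2 · suc l) eq) (2^[1+k]∸2-double k)

-- The Hankel determinants `E(n)`, here `hankel A₂ n`.

A₂ : ℕ → ℤ
A₂ m = A (2 · m)

hankel-A : ∀ n → hankel A n ≡ hankel A₂ ⌈ n /2⌉ ℤ.* hankel A ⌊ n /2⌋
hankel-A n = trans (hankel-checkerboard A A-odd n) (cong (hankel A₂ ⌈ n /2⌉ ℤ.*_)
  (ldet-cong (λ i j → A-even (i + j)) (upTo ⌊ n /2⌋) (upTo ⌊ n /2⌋)))

cornerMinor : ℕ → ℕ → ℤ
cornerMinor i j = A₂ (suc i + suc j)

cornerMinor≡A : ∀ i j → cornerMinor i j ≡ A (suc (i + j))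
cornerMinor≡A i j = trans (A-even (i + suc j)) (cong A (ℕ.+-suc i j))

A-2+2* : ∀ m → A (suc (suc (2 · m))) ≡ A m
A-2+2* m = trans (cong A (sym (ℕ.*-suc 2 m))) (A-even m)

-- The entry `A (i + j + 1)` vanishes for even `i + j`, and `A (2m + 2) = A m` makes both remaining
-- blocks Hankel matrices of `A`.
module CornerMinor = Antidiagonal cornerMinor A
  (λ a b → trans (cornerMinor≡A (2 · a) (2 · b))
    (trans (cong (A ∘ suc) (even+even a b)) (A-odd (a + b))))
  (λ a b → trans (cornerMinor≡A (suc (2 · a)) (suc (2 · b)))
    (trans (cong (A ∘ suc) (odd+odd a b)) (A-odd (suc (a + b)))))
  (λ a b → trans (cornerMinor≡A (2 · a) (suc (2 · b)))
    (trans (cong (A ∘ suc) (even+odd a b)) (A-2+2* (a + b))))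
  (λ a b → trans (cornerMinor≡A (suc (2 · a)) (2 · b))
    (trans (cong (A ∘ suc) (odd+even a b)) (A-2+2* (a + b))))

-- One halving turns `A (4m + 4)` into the odd term `A (2m + 1)`. Index 0 is different, as
-- `A₂ 0 = 1`; hence the separate treatment of the corner.
A₂-positive-even : ∀ m → A₂ (2 · suc m) ≡ 0ℤ
A₂-positive-even m = trans (cong A₂ (ℕ.*-suc 2 m)) (trans (A-even (suc (2 · m))) (A-odd m))

cleared : ℕ → ℕ → ℤ
cleared = clearCorner (λ i j → A₂ (i + j))

cleared-even-even : ∀ a b → cleared (2 · a) (2 · b) ≡ 0ℤ
cleared-even-even zero    zero    = refl
cleared-even-even zero    (suc b) = A₂-positive-even b
cleared-even-even (suc a) b       = trans (cong A₂ (even+even (suc a) b)) (A₂-positive-even (a + b))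

cleared-even-odd : ∀ a b → cleared (2 · a) (suc (2 · b)) ≡ A₂ (a + b)
cleared-even-odd zero    b = A-even (2 · b)
cleared-even-odd (suc a) b = trans (cong A₂ (even+odd (suc a) b)) (A-even (2 · (suc a + b)))

-- Here `A₂ (2m + 1) = A (4m + 2) = A (2m) = A₂ m`, so the blocks reproduce `A₂` itself.
module Cleared = Antidiagonal cleared A₂ cleared-even-even
  (λ a b → trans (cong A₂ (odd+odd a b)) (A₂-positive-even (a + b)))
  cleared-even-odd
  (λ a b → trans (cong A₂ (odd+even a b)) (A-even (2 · (a + b))))

hankel-A₂-suc : ∀ m → hankel A₂ (suc m) ≡
  ldet cornerMinor (upTo m) (upTo m) ℤ.+ ldet cleared (upTo (suc m)) (upTo (suc m))
hankel-A₂-suc m = begin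
  hankel A₂ (suc m)
    ≡⟨ cong (λ is → ldet C (0 ∷ is) (0 ∷ is)) tail ⟩
  ldet C (0 ∷ map suc (upTo m)) (0 ∷ map suc (upTo m))
    ≡⟨ ldet-corner C (upTo m) (upTo m) ⟩
  -- The corner entry `A₂ 0` evaluates to 1.
  1ℤ ℤ.* ldet cornerMinor (upTo m) (upTo m)
    ℤ.+ ldet cleared (0 ∷ map suc (upTo m)) (0 ∷ map suc (upTo m))
    ≡⟨ cong₂ ℤ._+_ (ℤ.*-identityˡ (ldet cornerMinor (upTo m) (upTo m)))
         (cong (λ is → ldet cleared (0 ∷ is) (0 ∷ is)) (sym tail)) ⟩
  ldet cornerMinor (upTo m) (upTo m) ℤ.+ ldet cleared (upTo (suc m)) (upTo (suc m)) ∎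
  where
  C : ℕ → ℕ → ℤ
  C i j = A₂ (i + j)
  tail : applyUpTo suc m ≡ map suc (upTo m)
  tail = sym (map-applyUpTo id suc m)

-- Values of the Hankel determinants by strong induction.

IsUnit : ℤ → Set
IsUnit x = x ≡ 1ℤ ⊎ x ≡ -1ℤ

unit-* : ∀ {x y} → IsUnit x → IsUnit y → IsUnit (x ℤ.* y)
unit-* (inj₁ refl) (inj₁ refl) = inj₁ refl
unit-* (inj₁ refl) (inj₂ refl) = inj₂ refl
unit-* (inj₂ refl) (inj₁ refl) = inj₂ refl
unit-* (inj₂ refl) (inj₂ refl) = inj₁ refl

unit² : ∀ {x} → IsUnit x → x ℤ.* x ≡ 1ℤ
unit² (inj₁ refl) = refl
unit² (inj₂ refl) = refl

unit-sign : ∀ n → IsUnit (-1ℤ ℤ.^ n)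
unit-sign zero    = inj₁ refl
unit-sign (suc n) = unit-* (inj₂ refl) (unit-sign n)

halves : ∀ n → ⌈ n /2⌉ ≡ ⌊ n /2⌋ ⊎ ⌈ n /2⌉ ≡ suc ⌊ n /2⌋
halves zero       = inj₁ refl
halves (suc zero) = inj₂ refl
halves (suc (suc n)) with halves n
... | inj₁ eq = inj₁ (cong suc eq)
... | inj₂ eq = inj₂ (cong suc eq)

-- The two terms of `hankel-A₂-suc` have the consecutive sizes `m` and `m + 1`; only the one of even
-- size survives, as a sign times the square of a unit.
hankel-A₂-step : ∀ m → IsUnit (hankel A ⌊ m /2⌋) → IsUnit (hankel A₂ ⌈ m /2⌉) →
  hankel A₂ (suc m) ≡ -1ℤ ℤ.^ ⌈ m /2⌉
hankel-A₂-step m uA uA₂ with halves m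
... | inj₁ eq = begin
  hankel A₂ (suc m)
    ≡⟨ trans (hankel-A₂-suc m) (cong₂ ℤ._+_
         (trans (CornerMinor.ldet-balanced m eq) (cong (-1ℤ ℤ.^ ⌊ m /2⌋ ℤ.*_) (unit² uA)))
         -- By computation `⌈ suc m /2⌉` is `suc ⌊ m /2⌋` and `⌊ suc m /2⌋` is `⌈ m /2⌉`.
         (Cleared.ldet-unbalanced (suc m) λ eq′ → ℕ.1+n≢n (trans eq′ eq))) ⟩
  -1ℤ ℤ.^ ⌊ m /2⌋ ℤ.* 1ℤ ℤ.+ 0ℤ
    ≡⟨ trans (ℤ.+-identityʳ _) (ℤ.*-identityʳ _) ⟩
  -1ℤ ℤ.^ ⌊ m /2⌋
    ≡⟨ cong (-1ℤ ℤ.^_) eq ⟨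
  -1ℤ ℤ.^ ⌈ m /2⌉ ∎
... | inj₂ eq = begin
  hankel A₂ (suc m)
    ≡⟨ trans (hankel-A₂-suc m) (cong₂ ℤ._+_
         (CornerMinor.ldet-unbalanced m λ eq′ → ℕ.1+n≢n (trans (sym eq) eq′))
         (trans (Cleared.ldet-balanced (suc m) (sym eq))
                (cong (-1ℤ ℤ.^ ⌈ m /2⌉ ℤ.*_) (unit² uA₂)))) ⟩
  0ℤ ℤ.+ -1ℤ ℤ.^ ⌈ m /2⌉ ℤ.* 1ℤ
    ≡⟨ trans (ℤ.+-identityˡ _) (ℤ.*-identityʳ _) ⟩
  -1ℤ ℤ.^ ⌈ m /2⌉ ∎

-- A joint statement, because the recursion for each of the two determinants calls the other.
HankelValues : ℕ → Set
HankelValues n = hankel A₂ n ≡ -1ℤ ℤ.^ ⌊ n /2⌋ × IsUnit (hankel A n)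

sign⇒unit : ∀ {x} n → x ≡ -1ℤ ℤ.^ n → IsUnit x
sign⇒unit n eq = subst IsUnit (sym eq) (unit-sign n)

hankelValues-step : ∀ n → (∀ {m} → m < n → HankelValues m) → HankelValues n
hankelValues-step zero          ih = refl , inj₁ refl
-- Size 1 is evaluated directly: `⌈ 1 /2⌉ = 1` gives no descent.
hankelValues-step (suc zero)    ih = refl , inj₁ refl
hankelValues-step (suc (suc n)) ih =
  hankel-A₂-step (suc n) (unitA (s≤s (ℕ.⌊n/2⌋≤n (suc n)))) (unitA₂ (s≤s (ℕ.⌈n/2⌉≤n (suc n))))
  , subst IsUnit (sym (hankel-A (suc (suc n))))
      (unit-* (unitA₂ (ℕ.⌈n/2⌉<n n)) (unitA (ℕ.⌊n/2⌋<n (suc n))))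
  where
  unitA : ∀ {m} → m < suc (suc n) → IsUnit (hankel A m)
  unitA m< = proj₂ (ih m<)
  unitA₂ : ∀ {m} → m < suc (suc n) → IsUnit (hankel A₂ m)
  unitA₂ {m} m< = sign⇒unit ⌊ m /2⌋ (proj₁ (ih m<))

hankelValues : ∀ n → HankelValues n
hankelValues = <-rec HankelValues hankelValues-step

-- Halving formulas for `D`, and the recurrences over the integers.

D-unit : D≡±1
D-unit n = subst IsUnit (sym (D≡hankel n)) (proj₂ (hankelValues n))

D-halves : ∀ n → D n ≡ -1ℤ ℤ.^ ⌊ ⌈ n /2⌉ /2⌋ ℤ.* D ⌊ n /2⌋
D-halves n = trans (D≡hankel n) (trans (hankel-A n)
  (cong₂ ℤ._*_ (proj₁ (hankelValues ⌈ n /2⌉)) (sym (D≡hankel ⌊ n /2⌋))))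

⌊2*n/2⌋≡n : ∀ n → ⌊ 2 · n /2⌋ ≡ n
⌊2*n/2⌋≡n n = trans (cong (λ k → ⌊ n + k /2⌋) (ℕ.+-identityʳ n)) (sym (ℕ.n≡⌊n+n/2⌋ n))

⌈2*n/2⌉≡n : ∀ n → ⌈ 2 · n /2⌉ ≡ n
⌈2*n/2⌉≡n n = trans (cong (λ k → ⌈ n + k /2⌉) (ℕ.+-identityʳ n)) (sym (ℕ.n≡⌈n+n/2⌉ n))

D-even : ∀ n → D (2 · n) ≡ -1ℤ ℤ.^ ⌊ n /2⌋ ℤ.* D n
D-even n = trans (D-halves (2 · n))
  (cong₂ (λ k l → -1ℤ ℤ.^ ⌊ k /2⌋ ℤ.* D l) (⌈2*n/2⌉≡n n) (⌊2*n/2⌋≡n n))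

D-odd : ∀ n → D (suc (2 · n)) ≡ -1ℤ ℤ.^ ⌊ suc n /2⌋ ℤ.* D n
D-odd n = trans (D-halves (suc (2 · n)))
  (cong₂ (λ k l → -1ℤ ℤ.^ ⌊ suc k /2⌋ ℤ.* D l) (⌊2*n/2⌋≡n n) (⌈2*n/2⌉≡n n))

-- The integer value of `T`, whose denominator is 1. Writing `suc (suc n)` for `n + 2` lets the
-- index compute.
t : ℕ → ℤ
t n = D n ℤ.* D (suc (suc n))

t-unit : ∀ n → IsUnit (t n)
t-unit n = unit-* (D-unit n) (D-unit (suc (suc n)))

t-even : ∀ n → t (2 · n) ≡
  (-1ℤ ℤ.^ ⌊ n /2⌋ ℤ.* D n) ℤ.* (-1ℤ ℤ.^ ⌊ suc n /2⌋ ℤ.* D (suc n))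
t-even n = cong₂ ℤ._*_ (D-even n) (trans (cong D (sym (ℕ.*-suc 2 n))) (D-even (suc n)))

t-odd : ∀ n → t (suc (2 · n)) ≡
  (-1ℤ ℤ.^ ⌊ suc n /2⌋ ℤ.* D n) ℤ.* (-1ℤ ℤ.* -1ℤ ℤ.^ ⌊ n /2⌋ ℤ.* D (suc n))
t-odd n = cong₂ ℤ._*_ (D-odd n) (trans (cong (D ∘ suc) (sym (ℕ.*-suc 2 n))) (D-odd (suc n)))

-- Both products contain the same two signs and the same two values of `D`, up to the factor `-1`
-- from `⌊ suc (suc n) /2⌋ = suc ⌊ n /2⌋`.
t-odd≡-t-even : ∀ n → t (suc (2 · n)) ≡ ℤ.- t (2 · n)
t-odd≡-t-even n = trans (t-odd n) (trans
  (rearrange (-1ℤ ℤ.^ ⌊ n /2⌋) (-1ℤ ℤ.^ ⌊ suc n /2⌋) (D n) (D (suc n)))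
  (cong ℤ.-_ (sym (t-even n))))
  where
  rearrange : ∀ s u d e → (u ℤ.* d) ℤ.* (-1ℤ ℤ.* s ℤ.* e) ≡ ℤ.- ((s ℤ.* d) ℤ.* (u ℤ.* e))
  rearrange = solve-∀

t-even≡t-odd*t : ∀ n → t (2 · suc n) ≡ t (suc (2 · n)) ℤ.* t n
t-even≡t-odd*t n = begin
  t (2 · suc n)
    ≡⟨ t-even (suc n) ⟩
  (u ℤ.* D (suc n)) ℤ.* (-1ℤ ℤ.* s ℤ.* D (suc (suc n)))
    ≡⟨ ℤ.*-identityˡ _ ⟨
  1ℤ ℤ.* ((u ℤ.* D (suc n)) ℤ.* (-1ℤ ℤ.* s ℤ.* D (suc (suc n))))
    -- The square of `D n` is inserted to supply the factor `D n` missing from each of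
    -- `t (suc (2 · n))` and `t n`.
    ≡⟨ cong (ℤ._* ((u ℤ.* D (suc n)) ℤ.* (-1ℤ ℤ.* s ℤ.* D (suc (suc n)))))
         (unit² (D-unit n)) ⟨
  D n ℤ.* D n ℤ.* ((u ℤ.* D (suc n)) ℤ.* (-1ℤ ℤ.* s ℤ.* D (suc (suc n))))
    ≡⟨ rearrange s u (D n) (D (suc n)) (D (suc (suc n))) ⟩
  (u ℤ.* D n) ℤ.* (-1ℤ ℤ.* s ℤ.* D (suc n)) ℤ.* t n
    ≡⟨ cong (ℤ._* t n) (t-odd n) ⟨
  t (suc (2 · n)) ℤ.* t n ∎
  where
  s = -1ℤ ℤ.^ ⌊ n /2⌋
  u = -1ℤ ℤ.^ ⌊ suc n /2⌋
  rearrange : ∀ s u d e f → d ℤ.* d ℤ.* ((u ℤ.* e) ℤ.* (-1ℤ ℤ.* s ℤ.* f))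
    ≡ (u ℤ.* d) ℤ.* (-1ℤ ℤ.* s ℤ.* e) ℤ.* (d ℤ.* f)
  rearrange = solve-∀

-- Transfer to the rationals.

fromℤ-* : ∀ {x y} → IsUnit x → IsUnit y → fromℤ (x ℤ.* y) ≡ fromℤ x * fromℤ y
fromℤ-* (inj₁ refl) (inj₁ refl) = refl
fromℤ-* (inj₁ refl) (inj₂ refl) = refl
fromℤ-* (inj₂ refl) (inj₁ refl) = refl
fromℤ-* (inj₂ refl) (inj₂ refl) = refl

fromℤ-neg : ∀ {x} → IsUnit x → fromℤ (ℤ.- x) ≡ - fromℤ x
fromℤ-neg (inj₁ refl) = refl
fromℤ-neg (inj₂ refl) = refl

-- With `q` a variable, matching on the equation replaces it by 1 inside the inverse as well.
÷-one : ∀ p q .{{_ : ℚ.NonZero q}} → q ≡ 1ℚ → p ÷ q ≡ p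
÷-one p _ refl = ℚ.*-identityʳ p

fromℤ-unit^2 : ∀ {x} → IsUnit x → fromℤ (x ℤ.^ 2) ≡ 1ℚ
fromℤ-unit^2 (inj₁ refl) = refl
fromℤ-unit^2 (inj₂ refl) = refl

T≡D*D : ∀ n → T D-unit n ≡ fromℤ (D n ℤ.* D (n + 2))
T≡D*D n = ÷-one (fromℤ (D n ℤ.* D (n + 2))) (fromℤ (D (n + 1) ℤ.^ 2))
  -- This nonzeroness proof differs from the one inside `T`, but the argument is irrelevant, so the
  -- quotients coincide.
  {{subst ℚ.NonZero (sym square≡1) _}} square≡1
  where
  square≡1 : fromℤ (D (n + 1) ℤ.^ 2) ≡ 1ℚ
  square≡1 = fromℤ-unit^2 (D-unit (n + 1))

T≡t : ∀ n → T D-unit n ≡ fromℤ (t n)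
T≡t n = trans (T≡D*D n) (cong (λ k → fromℤ (D n ℤ.* D k)) (ℕ.+-comm n 2))

T-even : ∀ n → n ≥ 1 → T D-unit (2 · n) ≡ T D-unit (2 · n ∸ 1) * T D-unit (n ∸ 1)
T-even (suc n) _ = begin
  T D-unit (2 · suc n)
    ≡⟨ T≡t (2 · suc n) ⟩
  fromℤ (t (2 · suc n))
    ≡⟨ cong fromℤ (t-even≡t-odd*t n) ⟩
  fromℤ (t (suc (2 · n)) ℤ.* t n)
    ≡⟨ fromℤ-* (t-unit (suc (2 · n))) (t-unit n) ⟩
  fromℤ (t (suc (2 · n))) * fromℤ (t n)
    ≡⟨ cong₂ _*_ (T≡t (suc (2 · n))) (T≡t n) ⟨
  T D-unit (suc (2 · n)) * T D-unit n
    ≡⟨ cong (λ k → T D-unit (k ∸ 1) * T D-unit n) (ℕ.*-suc 2 n) ⟨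
  T D-unit (2 · suc n ∸ 1) * T D-unit n ∎

T-odd : ∀ n → T D-unit (2 · n + 1) ≡ - T D-unit (2 · n)
T-odd n = begin
  T D-unit (2 · n + 1)       ≡⟨ cong (T D-unit) (ℕ.+-comm (2 · n) 1) ⟩
  T D-unit (suc (2 · n))     ≡⟨ T≡t (suc (2 · n)) ⟩
  fromℤ (t (suc (2 · n)))    ≡⟨ cong fromℤ (t-odd≡-t-even n) ⟩
  fromℤ (ℤ.- t (2 · n))      ≡⟨ fromℤ-neg (t-unit (2 · n)) ⟩
  - fromℤ (t (2 · n))        ≡⟨ cong -_ (T≡t (2 · n)) ⟨
  - T D-unit (2 · n)         ∎

theorem2p6 : Σ[ h ∈ D≡±1 ]
    (∀ (n : ℕ) → T h n ≡ fromℤ (D n ℤ.* D (n + 2)))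
    × T h 0 ≡ 1ℚ
    × T h 1 ≡ - 1ℚ
    × (∀ (n : ℕ) → n ≥ 1 → T h (2 · n) ≡ T h (2 · n ∸ 1) * T h (n ∸ 1))
    × (∀ (n : ℕ) → T h (2 · n + 1) ≡ - T h (2 · n))
-- The initial values come from evaluating determinants of size at most 3.
theorem2p6 = D-unit , T≡D*D , T≡t 0 , T≡t 1 , T-even , T-odd
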